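{- For any integers $n$ and $k$ with $2\leq k\leq \lfloor n/2 \rfloor$, $$\gamma_{oitR}(C(n,k))=n-\left\lfloor\frac{\left\lfloor \frac{n}{k+1} \right\rfloor}{2}\right\rfloor.$$
   Context: For integers $n$ and $0<k\leq\lfloor n/2\rfloor$, $C(n,k)$ denotes the circulant graph with vertex set $\{v_0,v_1,\ldots,v_{n-1}\}$ in which each $v_i$ is adjacent to $v_{i+j}$ and $v_{i-j}$ for $j=1,\ldots,k$, subscripts taken modulo $n$ (as a simple graph). For a graph $G$ with no isolated vertex and a function $f:V(G)\to\{0,1,2\}$, let $V_i=\{v\in V(G): f(v)=i\}$ for $i\in\{0,1,2\}$. The function $f$ is an outer-independent total Roman dominating function on $G$ if (i) every vertex in $V_0$ is adjacent to at least one vertex in $V_2$; (ii) $V_0$ is an independent set; and (iii) the subgraph induced by $V_1\cup V_2$ has no isolated vertex. The outer-independent total Roman domination number $\gamma_{oitR}(G)$ is the minimum weight $\omega(f)=\sum_{v\in V(G)}f(v)$ among all such functions. -}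

module Defs where

open import Data.Fin using (Fin; toℕ)
open import Data.Fin.Patterns using (0F; 1F; 2F)
open import Data.Fin.Properties using (nonZeroIndex)
open import Data.Nat using (ℕ; _+_; _≤_)
open import Data.Nat.DivMod using (_mod_)
open import Data.Nat.Properties using (+-0-commutativeMonoid)
open import Data.Product using (∃-syntax; _×_; _,_)
open import Data.Sum using (_⊎_; swap)
open import Function using (_∘_)
open import Level using (0ℓ)
open import Relation.Binary using (Rel; Symmetric; Irreflexive)
open import Relation.Binary.PropositionalEquality using (_≡_; _≢_; sym)
open import Relation.Nullary using (¬_)
open import Relation.Unary using (Pred; _∈_; _∪_)
open import Algebra.Properties.CommutativeMonoid.Sum +-0-commutativeMonoid using (sum)

record Graph (n : ℕ) : Set₁ where
  field
    Adj        : Rel (Fin n) 0ℓ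
    adj-sym    : Symmetric Adj
    adj-irrefl : Irreflexive _≡_ Adj

open Graph public

module _ {n : ℕ} (G : Graph n) where

  Independent : Pred (Fin n) 0ℓ → Set
  Independent S = ∀ u v → u ∈ S → v ∈ S → ¬ Adj G u v

  -- The subgraph of G induced by S has no isolated vertex.
  InducedNoIsolated : Pred (Fin n) 0ℓ → Set
  InducedNoIsolated S = ∀ v → v ∈ S → ∃[ u ] (u ∈ S × Adj G v u)

V : ∀ {n} → (Fin n → Fin 3) → Fin 3 → Pred (Fin n) 0ℓ
V f i v = f v ≡ i

weight : ∀ {n} → (Fin n → Fin 3) → ℕ
weight f = sum (toℕ ∘ f)

-- Outer-independent total Roman dominating functions.
record IsOITRDF {n : ℕ} (G : Graph n) (f : Fin n → Fin 3) : Set where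
  field
    dominated   : ∀ v → v ∈ V f 0F → ∃[ u ] (u ∈ V f 2F × Adj G v u)
    independent : Independent G (V f 0F)
    total       : InducedNoIsolated G (V f 1F ∪ V f 2F)

-- γoitR G ≔ m means that m is the minimum weight of an outer-independent
-- total Roman dominating function on G.  The usual proviso that G has no
-- isolated vertex need not be imposed: `dominated` and `total` together give
-- every vertex a neighbour, so the relation is empty for any other G.
record γoitR_≔_ {n : ℕ} (G : Graph n) (m : ℕ) : Set where
  field
    attained : ∃[ f ] (IsOITRDF G f × weight f ≡ m)
    minimal  : ∀ f → IsOITRDF G f → m ≤ weight f

-- Index addition modulo n: the vertex v_{i+j}.
_⊕_ : ∀ {n} → Fin n → ℕ → Fin n
_⊕_ {n} i j = _mod_ (toℕ i + j) n {{nonZeroIndex i}}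

-- The circulant graph C(n,k).  The condition u ≡ v ⊕ j says that v is v_{i-j}
-- when u is v_i.  The condition u ≢ v rules out loops; it is redundant when
-- k < n, in particular when 0 < k ≤ ⌊ n /2⌋.
C : (n k : ℕ) → Graph n
C n k = record
  { Adj        = λ u v → u ≢ v × ∃[ j ] (1 ≤ j × j ≤ k × (v ≡ u ⊕ j ⊎ u ≡ v ⊕ j))
  ; adj-sym    = λ (u≢v , j , 1≤j , j≤k , p) → u≢v ∘ sym , j , 1≤j , j≤k , swap p
  ; adj-irrefl = λ u≡v (u≢v , _) → u≢v u≡v
  }

-- Let z = |V₀| and t = |V₂|, so that ω(f) + z = n + t.  Any k+1 cyclically
-- consecutive vertices form a clique and hence contain at most one vertex of
-- V₀; summing over all such windows gives (k+1) z ≤ n.  The k vertices on either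
-- side of a vertex of V₂ also contain at most one vertex of V₀ each, so z ≤ 2 t.
-- Thus z − t ≤ ⌊z/2⌋ ≤ ⌊⌊n/(k+1)⌋/2⌋.  Equality holds for m = ⌊⌊n/(k+1)⌋/2⌋
-- copies of the word 0 2 1…1 0 1…1 (two blocks of length k+1) followed by ones.
module Submission where

open import Defs
open import Data.Nat using (ℕ; suc; _∸_; _≤_; _/_)
open import Data.Fin using (Fin; zero; suc; toℕ; fromℕ<)
open import Data.Fin.Patterns using (0F; 1F; 2F)
open import Data.Fin.Permutation
  using (Permutation′; permutation; flip; _⟨$⟩ʳ_; _⟨$⟩ˡ_; inverseʳ)
open import Data.Fin.Properties
  using (nonZeroIndex; toℕ-fromℕ<; toℕ-injective; toℕ<n)
open import Data.Nat using
  (zero; _+_; _*_; _<_; z≤n; s≤s; s≤s⁻¹; s<s⁻¹; z<s; s<s; >-nonZero)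
open import Data.Nat.DivMod
open import Data.Nat.Properties
open import Algebra.Properties.CommutativeMonoid.Sum +-0-commutativeMonoid
  using (sum; sum-syntax; sum-cong-≗; ∑-distrib-+; ∑-comm; sum-permute)
open import Algebra.Properties.Semiring.Sum +-*-semiring
  using (*-distribʳ-sum)
open import Data.Nat.Solver using (module +-*-Solver)
open import Data.Product using (∃-syntax; _×_; _,_)
open import Data.Sum using (_⊎_; inj₁; inj₂)
open import Function using (_∘_)
open import Relation.Binary.PropositionalEquality
open import Relation.Nullary using (contradiction)

-- Finite sums and double counting

sum-mono-≤ : ∀ {n} {f g : Fin n → ℕ} → (∀ i → f i ≤ g i) → sum f ≤ sum g
sum-mono-≤ {zero}  f≤g = z≤n
sum-mono-≤ {suc n} f≤g = +-mono-≤ (f≤g zero) (sum-mono-≤ (f≤g ∘ suc))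

sum-const : ∀ n c → ∑[ i < n ] c ≡ n * c
sum-const zero    c = refl
sum-const (suc n) c = cong (c +_) (sum-const n c)

term≤sum : ∀ {n} (f : Fin n → ℕ) i → f i ≤ sum f
term≤sum f zero    = m≤m+n (f zero) _
term≤sum f (suc i) = ≤-trans (term≤sum (f ∘ suc) i) (m≤n+m _ (f zero))

-- A discharging bound. Each `π j` is a bijection, so the sum over `u` can be reindexed by `w`, the
-- image of `u`; after exchanging the sums, every `h w` is multiplied by the total `g` of the
-- preimages of `w`, which is at most 1.
double-counting : ∀ {n l} (g h : Fin n → ℕ) (π : Fin l → Permutation′ n) →
  (∀ w → ∑[ j < l ] g (π j ⟨$⟩ˡ w) ≤ 1) →
  ∑[ u < n ] ∑[ j < l ] (g u * h (π j ⟨$⟩ʳ u)) ≤ sum h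
double-counting {n} {l} g h π fibre≤1 = begin
  ∑[ u < n ] ∑[ j < l ] (g u * h (π j ⟨$⟩ʳ u))
    ≡⟨ ∑-comm (λ u j → g u * h (π j ⟨$⟩ʳ u)) ⟩
  ∑[ j < l ] ∑[ u < n ] (g u * h (π j ⟨$⟩ʳ u))
    ≡⟨ sum-cong-≗ (λ j → trans
         (sum-permute (λ u → g u * h (π j ⟨$⟩ʳ u)) (flip (π j)))
         (sum-cong-≗ λ w → cong (λ v → g (π j ⟨$⟩ˡ w) * h v) (inverseʳ (π j)))) ⟩
  ∑[ j < l ] ∑[ w < n ] (g (π j ⟨$⟩ˡ w) * h w)
    ≡⟨ ∑-comm (λ j w → g (π j ⟨$⟩ˡ w) * h w) ⟩
  ∑[ w < n ] ∑[ j < l ] (g (π j ⟨$⟩ˡ w) * h w)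
    ≤⟨ sum-mono-≤ (λ w → begin
         ∑[ j < l ] (g (π j ⟨$⟩ˡ w) * h w)  ≡⟨ *-distribʳ-sum (h w) (λ j → g (π j ⟨$⟩ˡ w)) ⟨
         ∑[ j < l ] g (π j ⟨$⟩ˡ w) * h w    ≤⟨ *-monoˡ-≤ (h w) (fibre≤1 w) ⟩
         1 * h w                            ≡⟨ *-identityˡ (h w) ⟩
         h w                                ∎) ⟩
  sum h ∎
  where open ≤-Reasoning

-- Rotations of the cycle and adjacency

toℕ-⊕ : ∀ {n} (u : Fin n) j → toℕ (u ⊕ j) ≡ _%_ (toℕ u + j) n {{nonZeroIndex u}}
toℕ-⊕ u j = toℕ-fromℕ< _

-- Since `toℕ u < n` and `j ≤ n`, the sum stays below `n + n`, so reduction modulo `n` subtracts `n`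
-- at most once.
⊕-wrap : ∀ {n} (u : Fin n) {j} → j ≤ n →
  toℕ (u ⊕ j) ≡ toℕ u + j ⊎ toℕ (u ⊕ j) + n ≡ toℕ u + j
⊕-wrap {n} u {j} j≤n with <-≤-connex (toℕ u + j) n
... | inj₁ u+j<n = inj₁ (trans (toℕ-⊕ u j) (m<n⇒m%n≡m {{nonZeroIndex u}} u+j<n))
... | inj₂ n≤u+j = inj₂ (begin
  toℕ (u ⊕ j) + n              ≡⟨ cong (_+ n) (toℕ-⊕ u j) ⟩
  (toℕ u + j) % n + n          ≡⟨ cong (_+ n) (m≤n⇒[n∸m]%m≡n%m n≤u+j) ⟨
  (toℕ u + j ∸ n) % n + n      ≡⟨ cong (_+ n) (m<n⇒m%n≡m (m<n+o⇒m∸n<o (toℕ u + j) n (+-mono-<-≤ (toℕ<n u) j≤n))) ⟩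
  toℕ u + j ∸ n + n            ≡⟨ m∸n+n≡m n≤u+j ⟩
  toℕ u + j                    ∎)
  where open ≡-Reasoning
        instance _ = nonZeroIndex u

toℕ≡+⇒≡⊕ : ∀ {n} (u v : Fin n) j → toℕ v ≡ toℕ u + j → v ≡ u ⊕ j
toℕ≡+⇒≡⊕ {n} u v j v≡u+j = toℕ-injective (begin
  toℕ v            ≡⟨ m<n⇒m%n≡m (toℕ<n v) ⟨
  toℕ v % n        ≡⟨ cong (_% n) v≡u+j ⟩
  (toℕ u + j) % n  ≡⟨ toℕ-⊕ u j ⟨
  toℕ (u ⊕ j)      ∎)
  where open ≡-Reasoning
        instance _ = nonZeroIndex u

⊕-⊕ : ∀ {n} (u : Fin n) i j → (u ⊕ i) ⊕ j ≡ u ⊕ (i + j)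
⊕-⊕ {n} u i j = toℕ-injective (begin
  toℕ ((u ⊕ i) ⊕ j)                ≡⟨ toℕ-⊕ (u ⊕ i) j ⟩
  (toℕ (u ⊕ i) + j) % n            ≡⟨ cong (λ x → (x + j) % n) (toℕ-⊕ u i) ⟩
  ((toℕ u + i) % n + j) % n        ≡⟨ %-distribˡ-+ ((toℕ u + i) % n) j n ⟩
  ((toℕ u + i) % n % n + j % n) % n ≡⟨ cong (λ x → (x + j % n) % n) (m%n%n≡m%n (toℕ u + i) n) ⟩
  ((toℕ u + i) % n + j % n) % n    ≡⟨ %-distribˡ-+ (toℕ u + i) j n ⟨
  (toℕ u + i + j) % n              ≡⟨ cong (_% n) (+-assoc (toℕ u) i j) ⟩
  (toℕ u + (i + j)) % n            ≡⟨ toℕ-⊕ u (i + j) ⟨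
  toℕ (u ⊕ (i + j))                ∎)
  where open ≡-Reasoning
        instance _ = nonZeroIndex u

⊕-n : ∀ {n} (u : Fin n) → u ⊕ n ≡ u
⊕-n {n} u = toℕ-injective (begin
  toℕ (u ⊕ n)      ≡⟨ toℕ-⊕ u n ⟩
  (toℕ u + n) % n  ≡⟨ [m+n]%n≡m%n (toℕ u) n ⟩
  toℕ u % n        ≡⟨ m<n⇒m%n≡m (toℕ<n u) ⟩
  toℕ u            ∎)
  where open ≡-Reasoning
        instance _ = nonZeroIndex u

⊕-⊖ : ∀ {n} (u : Fin n) {j} → j ≤ n → (u ⊕ j) ⊕ (n ∸ j) ≡ u
⊕-⊖ {n} u {j} j≤n = trans (⊕-⊕ u j (n ∸ j)) (trans (cong (u ⊕_) (m+[n∸m]≡n j≤n)) (⊕-n u))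

⊖-⊕ : ∀ {n} (u : Fin n) {j} → j ≤ n → (u ⊕ (n ∸ j)) ⊕ j ≡ u
⊖-⊕ {n} u {j} j≤n = trans (⊕-⊕ u (n ∸ j) j) (trans (cong (u ⊕_) (m∸n+n≡m j≤n)) (⊕-n u))

-- Stepping back by `j` is written as stepping forward by `n ∸ j`.
rotation : ∀ {n} j → j ≤ n → Permutation′ n
rotation {n} j j≤n = permutation (_⊕ j) (_⊕ (n ∸ j)) (λ u → ⊖-⊕ u j≤n) (λ u → ⊕-⊖ u j≤n)

-- A fixed point of the shift would force `j` to be 0 without wrap-around, or `n` with it.
≢-⊕ : ∀ {n} (u : Fin n) {j} → 1 ≤ j → j < n → u ≢ u ⊕ j
≢-⊕ {n} u {j} 1≤j j<n u≡u⊕j with ⊕-wrap u (<⇒≤ j<n)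
... | inj₁ eq = <⇒≢ 1≤j (+-cancelˡ-≡ (toℕ u) 0 j
                  (trans (+-identityʳ _) (trans (cong toℕ u≡u⊕j) eq)))
... | inj₂ eq = <⇒≢ j<n (sym (+-cancelˡ-≡ (toℕ u) n j
                  (trans (cong (λ v → toℕ v + n) u≡u⊕j) eq)))

adjacent-⊕ : ∀ {n k} (u : Fin n) {j} → k < n → 1 ≤ j → j ≤ k → Adj (C n k) u (u ⊕ j)
adjacent-⊕ u k<n 1≤j j≤k = ≢-⊕ u 1≤j (≤-<-trans j≤k k<n) , _ , 1≤j , j≤k , inj₁ refl

-- Counting labels

isZero isTwo : Fin 3 → ℕ
isZero 0F = 1
isZero _  = 0
isTwo 2F = 1
isTwo _  = 0

-- A vertex labelled 0, 1 or 2 contributes 1, 1 or 2 respectively to both sides.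
weight-identity : ∀ {n} (f : Fin n → Fin 3) →
  weight f + sum (isZero ∘ f) ≡ n + sum (isTwo ∘ f)
weight-identity {n} f = begin
  weight f + sum (isZero ∘ f)                 ≡⟨ ∑-distrib-+ (toℕ ∘ f) (isZero ∘ f) ⟨
  ∑[ v < n ] (toℕ (f v) + isZero (f v))       ≡⟨ sum-cong-≗ (λ v → pointwise (f v)) ⟩
  ∑[ v < n ] (1 + isTwo (f v))                ≡⟨ ∑-distrib-+ (λ _ → 1) (isTwo ∘ f) ⟩
  ∑[ v < n ] 1 + sum (isTwo ∘ f)              ≡⟨ cong (_+ sum (isTwo ∘ f)) (trans (sum-const n 1) (*-identityʳ n)) ⟩
  n + sum (isTwo ∘ f)                         ∎
  where
  open ≡-Reasoning
  pointwise : ∀ a → toℕ a + isZero a ≡ 1 + isTwo a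
  pointwise 0F = refl
  pointwise 1F = refl
  pointwise 2F = refl

sum-isZero≤1 : ∀ {l} (a : Fin l → Fin 3) →
  (∀ i j → toℕ i < toℕ j → a i ≡ 0F → a j ≢ 0F) → sum (isZero ∘ a) ≤ 1
sum-isZero≤1 {zero}  a unique = z≤n
sum-isZero≤1 {suc l} a unique with a zero in a₀≡
... | 0F = s≤s (≤-reflexive (trans (sum-cong-≗ (λ i → nonzero (unique zero (suc i) z<s a₀≡)))
                                   (trans (sum-const l 0) (*-zeroʳ l))))
  where
  nonzero : ∀ {b} → b ≢ 0F → isZero b ≡ 0
  nonzero {0F} b≢0 = contradiction refl b≢0
  nonzero {1F} _   = refl
  nonzero {2F} _   = refl
... | 1F = sum-isZero≤1 (a ∘ suc) (λ i j → unique (suc i) (suc j) ∘ s<s)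
... | 2F = sum-isZero≤1 (a ∘ suc) (λ i j → unique (suc i) (suc j) ∘ s<s)

-- Lower bound

module LowerBound {n k : ℕ} (k<n : k < n) {f : Fin n → Fin 3} (F : IsOITRDF (C n k) f) where
  open IsOITRDF F
  open ≤-Reasoning

  z t : ℕ
  z = sum (isZero ∘ f)
  t = sum (isTwo ∘ f)

  -- Two positions of the window differ by at most `k`, so they are adjacent and cannot both be
  -- labelled 0. Offset 0 with length `suc k` serves the clique count; offset 1 with length `k`
  -- gives the vertices following `w`.
  forward-window : ∀ {l} (o : ℕ) → o + l ≤ suc k → ∀ w →
    ∑[ i < l ] isZero (f (w ⊕ (o + toℕ i))) ≤ 1
  forward-window {l} o o+l≤1+k w = sum-isZero≤1 (λ i → f (w ⊕ (o + toℕ i))) λ i j i<j fi≡0 fj≡0 →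
    independent (w ⊕ (o + toℕ i)) (w ⊕ (o + toℕ j)) fi≡0 fj≡0
      (subst (Adj (C n k) _) (shift i j i<j)
        (adjacent-⊕ _ k<n (m<n⇒0<n∸m i<j) (bound i j)))
    where
    shift : ∀ (i j : Fin l) → toℕ i < toℕ j →
      (w ⊕ (o + toℕ i)) ⊕ (toℕ j ∸ toℕ i) ≡ w ⊕ (o + toℕ j)
    shift i j i<j = trans (⊕-⊕ w _ _) (cong (w ⊕_)
      (trans (+-assoc o _ _) (cong (o +_) (m+[n∸m]≡n (<⇒≤ i<j)))))
    bound : ∀ (i j : Fin l) → toℕ j ∸ toℕ i ≤ k
    bound i j = ≤-trans (m∸n≤m (toℕ j) (toℕ i))
      (s≤s⁻¹ (<-≤-trans (toℕ<n j) (≤-trans (m≤n+m l o) o+l≤1+k)))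

  -- The same clique argument for the `k` vertices preceding `w`. The larger index lies further
  -- back, so the shift by `toℕ j ∸ toℕ i` leads from position `j` to position `i`.
  backward-window : ∀ w → ∑[ i < k ] isZero (f (w ⊕ (n ∸ suc (toℕ i)))) ≤ 1
  backward-window w = sum-isZero≤1 (λ i → f (w ⊕ (n ∸ suc (toℕ i)))) λ i j i<j fi≡0 fj≡0 →
    independent (w ⊕ (n ∸ suc (toℕ j))) (w ⊕ (n ∸ suc (toℕ i))) fj≡0 fi≡0
      (subst (Adj (C n k) _) (shift i j i<j)
        (adjacent-⊕ _ k<n (m<n⇒0<n∸m i<j)
          (≤-trans (m∸n≤m (toℕ j) (toℕ i)) (<⇒≤ (toℕ<n j)))))
    where
    shift : ∀ (i j : Fin k) → toℕ i < toℕ j →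
      (w ⊕ (n ∸ suc (toℕ j))) ⊕ (toℕ j ∸ toℕ i) ≡ w ⊕ (n ∸ suc (toℕ i))
    shift i j i<j = trans (⊕-⊕ w _ _) (cong (w ⊕_) (begin-equality
      n ∸ suc (toℕ j) + (suc (toℕ j) ∸ suc (toℕ i)) ≡⟨ +-∸-assoc (n ∸ suc (toℕ j)) (s≤s (<⇒≤ i<j)) ⟨
      n ∸ suc (toℕ j) + suc (toℕ j) ∸ suc (toℕ i)   ≡⟨ cong (_∸ suc (toℕ i)) (m∸n+n≡m (≤-trans (toℕ<n j) (<⇒≤ k<n))) ⟩
      n ∸ suc (toℕ i)                               ∎))

  z*[1+k]≤n : z * suc k ≤ n
  z*[1+k]≤n = begin
    z * suc k                                ≡⟨ *-distribʳ-sum (suc k) (isZero ∘ f) ⟩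
    ∑[ u < n ] (isZero (f u) * suc k)        ≡⟨ sum-cong-≗ (λ u → trans (*-comm _ (suc k)) (trans (sym (sum-const (suc k) _))
                                                  (sum-cong-≗ {suc k} λ _ → sym (*-identityʳ (isZero (f u)))))) ⟩
    ∑[ u < n ] ∑[ j < suc k ] (isZero (f u) * 1)
      ≤⟨ double-counting (isZero ∘ f) (λ _ → 1)
           -- A zero at `u` charges one unit to each of the `suc k` vertices up to `k` places before
           -- it. The charges received by `w` then come from the window that starts at `w`.
           (λ j → flip (rotation (toℕ j) (≤-trans (<⇒≤ (toℕ<n j)) k<n)))
           (forward-window 0 ≤-refl) ⟩
    ∑[ u < n ] 1                             ≡⟨ trans (sum-const n 1) (*-identityʳ n) ⟩
    n                                        ∎

  -- Every zero charges each 2 within distance `k`, separately in the two directions, and makes at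
  -- least one charge because it is dominated. A 2 receives at most one charge from either side.
  z≤t+t : z ≤ t + t
  z≤t+t = begin
    z ≤⟨ sum-mono-≤ (λ u → zero-near-two u) ⟩
    ∑[ u < n ] (ahead u + behind u) ≡⟨ ∑-distrib-+ ahead behind ⟩
    sum ahead + sum behind
      -- Zeros that look ahead to `w` lie behind `w`, and vice versa; hence the crossed pairing of
      -- sums and windows.
      ≤⟨ +-mono-≤ (double-counting (isZero ∘ f) (isTwo ∘ f) rot backward-window)
                  (double-counting (isZero ∘ f) (isTwo ∘ f) (flip ∘ rot) (forward-window 1 ≤-refl)) ⟩
    t + t ∎
    where
    1+j≤n : (j : Fin k) → suc (toℕ j) ≤ n
    1+j≤n j = ≤-trans (toℕ<n j) (<⇒≤ k<n)
    rot : Fin k → Permutation′ n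
    rot j = rotation (suc (toℕ j)) (1+j≤n j)
    ahead behind : Fin n → ℕ
    ahead u  = ∑[ j < k ] (isZero (f u) * isTwo (f (rot j ⟨$⟩ʳ u)))
    behind u = ∑[ j < k ] (isZero (f u) * isTwo (f (rot j ⟨$⟩ˡ u)))
    positive : ∀ {a b} → a ≡ 0F → b ≡ 2F → 1 ≤ isZero a * isTwo b
    positive refl refl = ≤-refl
    near : ∀ u → f u ≡ 0F → 1 ≤ ahead u + behind u
    near u fu≡0 with dominated u fu≡0
    -- Distances run from 1 to `k` and indices in `Fin k` from 0, so distance `suc j` is the term
    -- with index `j`.
    ... | w , fw≡2 , _ , suc j , _ , j<k , inj₁ w≡u⊕j = m≤n⇒m≤n+o (behind u)
      (≤-trans (positive fu≡0 (trans (cong f (sym at)) fw≡2))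
               (term≤sum (λ i → isZero (f u) * isTwo (f (rot i ⟨$⟩ʳ u))) (fromℕ< j<k)))
      where
      at : w ≡ rot (fromℕ< j<k) ⟨$⟩ʳ u
      at = trans w≡u⊕j (cong (λ x → u ⊕ suc x) (sym (toℕ-fromℕ< j<k)))
    ... | w , fw≡2 , _ , suc j , _ , j<k , inj₂ u≡w⊕j = m≤n⇒m≤o+n (ahead u)
      (≤-trans (positive fu≡0 (trans (cong f at) fw≡2))
               (term≤sum (λ i → isZero (f u) * isTwo (f (rot i ⟨$⟩ˡ u))) (fromℕ< j<k)))
      where
      at : rot (fromℕ< j<k) ⟨$⟩ˡ u ≡ w
      at = trans (cong₂ (λ v x → v ⊕ (n ∸ suc x)) u≡w⊕j (toℕ-fromℕ< j<k))
                 (⊕-⊖ w (≤-trans j<k (<⇒≤ k<n)))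
    zero-near-two : ∀ u → isZero (f u) ≤ ahead u + behind u
    zero-near-two u with f u in fu≡
    ... | 0F = subst (λ a → 1 ≤ ∑[ j < k ] (isZero a * isTwo (f (rot j ⟨$⟩ʳ u)))
                              + ∑[ j < k ] (isZero a * isTwo (f (rot j ⟨$⟩ˡ u)))) fu≡ (near u fu≡)
    ... | 1F = z≤n
    ... | 2F = z≤n

  z≤t+half : z ≤ t + n / suc k / 2
  z≤t+half = ≤-trans (m≤n+m∸n z t) (+-monoʳ-≤ t s≤half)
    where
    -- If `t ≤ z`, one copy of `z ∸ t` is at most `t`, and the other adds up with `t` to `z`;
    -- otherwise truncation makes both copies 0.
    s+s≤z : ∀ z t → z ≤ t + t → (z ∸ t) + (z ∸ t) ≤ z
    s+s≤z z t z≤t+t with ≤-total z t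
    ... | inj₁ z≤t rewrite m≤n⇒m∸n≡0 z≤t = z≤n
    ... | inj₂ t≤z = ≤-trans (+-monoʳ-≤ (z ∸ t) (m≤n+o⇒m∸n≤o z t z≤t+t)) (≤-reflexive (m∸n+n≡m t≤z))
    s≤half : z ∸ t ≤ n / suc k / 2
    s≤half = begin
      z ∸ t                 ≡⟨ m*n/n≡m (z ∸ t) 2 ⟨
      (z ∸ t) * 2 / 2       ≡⟨ cong (_/ 2) (trans (*-comm (z ∸ t) 2) (cong (z ∸ t +_) (+-identityʳ _))) ⟩
      (z ∸ t + (z ∸ t)) / 2 ≤⟨ /-monoˡ-≤ 2 (s+s≤z z t z≤t+t) ⟩
      z / 2                 ≡⟨ cong (_/ 2) (m*n/n≡m z (suc k)) ⟨
      z * suc k / suc k / 2 ≤⟨ /-monoˡ-≤ 2 (/-monoˡ-≤ (suc k) z*[1+k]≤n) ⟩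
      n / suc k / 2         ∎

  n∸half≤weight : n ∸ n / suc k / 2 ≤ weight f
  n∸half≤weight = m≤n+o⇒m∸n≤o n h (+-cancelʳ-≤ t n (h + weight f) (begin
    n + t                ≡⟨ weight-identity f ⟨
    weight f + z         ≤⟨ +-monoʳ-≤ (weight f) z≤t+half ⟩
    weight f + (t + h)   ≡⟨ solve 3 (λ w t h → w :+ (t :+ h) := h :+ w :+ t) refl (weight f) t h ⟩
    h + weight f + t     ∎))
    where
    open +-*-Solver
    h = n / suc k / 2

-- Concatenated words and the extremal labelling

-- The first w values are read from b, the later ones from g (re-indexed from 0).
prepend : ∀ {A : Set} → ℕ → (ℕ → A) → (ℕ → A) → ℕ → A
prepend zero    b g x       = g x
prepend (suc w) b g zero    = b zero
prepend (suc w) b g (suc x) = prepend w (b ∘ suc) g x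

module _ {A : Set} where

  prepend-< : ∀ w (b g : ℕ → A) {x} → x < w → prepend w b g x ≡ b x
  prepend-< (suc w) b g {zero}  _   = refl
  prepend-< (suc w) b g {suc x} x<w = prepend-< w (b ∘ suc) g (s<s⁻¹ x<w)

  prepend-+ : ∀ w (b g : ℕ → A) x → prepend w b g (w + x) ≡ g x
  prepend-+ zero    b g x = refl
  prepend-+ (suc w) b g x = prepend-+ w (b ∘ suc) g x

  prepend⁻ : ∀ w {b g : ℕ → A} x {a} → prepend w b g x ≡ a →
    (x < w × b x ≡ a) ⊎ ∃[ y ] (x ≡ w + y × g y ≡ a)
  prepend⁻ zero    x       eq = inj₂ (x , refl , eq)
  prepend⁻ (suc w) zero    eq = inj₁ (z<s , eq)
  prepend⁻ (suc w) (suc x) eq with prepend⁻ w x eq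
  ... | inj₁ (x<w , bx≡a)      = inj₁ (s<s x<w , bx≡a)
  ... | inj₂ (y , refl , gy≡a) = inj₂ (y , refl , gy≡a)

  sum-prepend : ∀ w n (h : A → ℕ) (b g : ℕ → A) →
    ∑[ i < w + n ] h (prepend w b g (toℕ i)) ≡ ∑[ i < w ] h (b (toℕ i)) + ∑[ i < n ] h (g (toℕ i))
  sum-prepend zero    n h b g = refl
  sum-prepend (suc w) n h b g =
    trans (cong (h (b 0) +_) (sum-prepend w n h (b ∘ suc) g)) (sym (+-assoc (h (b 0)) _ _))

-- The words 0 2 1...1 and 0 1...1 as infinite sequences; `prepend` cuts them to length `suc k`.
block₁ block₂ : ℕ → Fin 3
block₁ 0             = 0F
block₁ 1             = 2F
block₁ (suc (suc _)) = 1F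
block₂ 0       = 0F
block₂ (suc _) = 1F

labelling : ℕ → ℕ → ℕ → Fin 3
labelling k zero    = λ _ → 1F
labelling k (suc m) = prepend (suc k) block₁ (prepend (suc k) block₂ (labelling k m))

block₁-zero : ∀ x → block₁ x ≡ 0F → x ≡ 0
block₁-zero 0             _ = refl
block₁-zero (suc zero)    ()
block₁-zero (suc (suc _)) ()

block₂-zero : ∀ x → block₂ x ≡ 0F → x ≡ 0
block₂-zero 0 _ = refl

-- Each block has its only zero at its start, and `q` is the index of the block.
labelling-zero : ∀ k m x → labelling k m x ≡ 0F → ∃[ q ] (q < m * 2 × x ≡ q * suc k)
labelling-zero k (suc m) x eq with prepend⁻ (suc k) x eq
... | inj₁ (_ , b≡0) = 0 , z<s , block₁-zero x b≡0
... | inj₂ (y , x≡ , eq′) with prepend⁻ (suc k) y eq′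
...   | inj₁ (_ , b≡0) = 1 , s<s z<s , trans x≡ (cong (suc k +_) (block₂-zero y b≡0))
...   | inj₂ (y′ , y≡ , eq″) with labelling-zero k m y′ eq″
...     | q , q<2m , refl = 2 + q , s<s (s<s q<2m) , trans x≡ (cong (suc k +_) y≡)

-- In each pair of blocks the 2 at position 1 comes directly after the zero at 0 and `k` places
-- before the zero at `suc k`; `1 ≤ k` keeps position 1 inside the first block. The bound on `w`
-- later turns it into a vertex of the cycle.
labelling-dominated : ∀ k m x → 1 ≤ k → labelling k m x ≡ 0F →
  ∃[ w ] (labelling k m w ≡ 2F × w < m * 2 * suc k × (w ≡ x + 1 ⊎ x ≡ w + k))
labelling-dominated k (suc m) x 1≤k eq with prepend⁻ (suc k) x eq
... | inj₁ (_ , b≡0) =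
  1 , prepend-< (suc k) block₁ (prepend (suc k) block₂ (labelling k m)) (s<s 1≤k) , ≤-trans (s<s 1≤k) (m≤m+n (suc k) _) ,
  inj₁ (cong (_+ 1) (sym (block₁-zero x b≡0)))
... | inj₂ (y , refl , eq′) with prepend⁻ (suc k) y eq′
... | inj₁ (_ , b≡0) =
  1 , prepend-< (suc k) block₁ (prepend (suc k) block₂ (labelling k m)) (s<s 1≤k) , ≤-trans (s<s 1≤k) (m≤m+n (suc k) _) ,
  inj₂ (trans (cong (suc k +_) (block₂-zero y b≡0)) (+-identityʳ (suc k)))
... | inj₂ (y′ , refl , eq″) with labelling-dominated k m y′ 1≤k eq″
... | w , lw≡2 , w< , near =
  -- The witness for the remaining pairs, moved past the two blocks of the first pair.
  suc k + (suc k + w) ,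
  trans (prepend-+ (suc k) block₁ (prepend (suc k) block₂ (labelling k m)) _)
    (trans (prepend-+ (suc k) block₂ (labelling k m) w) lw≡2) ,
  +-monoʳ-< (suc k) (+-monoʳ-< (suc k) w<) ,
  shifted near
  where
  shift : ∀ {a} b c → a ≡ b + c → suc k + (suc k + a) ≡ suc k + (suc k + b) + c
  shift b c refl = trans (cong (suc k +_) (sym (+-assoc (suc k) b c))) (sym (+-assoc (suc k) _ c))
  shifted : w ≡ y′ + 1 ⊎ y′ ≡ w + k →
    suc k + (suc k + w) ≡ suc k + (suc k + y′) + 1 ⊎ suc k + (suc k + y′) ≡ suc k + (suc k + w) + k
  shifted (inj₁ p) = inj₁ (shift y′ 1 p)
  shifted (inj₂ p) = inj₂ (shift w k p)

-- The first block of a pair weighs as much as its length, the second one less, so every pair saves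
-- exactly 1; the `r` trailing ones save nothing.
labelling-weight : ∀ k m r → 1 ≤ k →
  weight {m * 2 * suc k + r} (labelling k m ∘ toℕ) + m ≡ m * 2 * suc k + r
labelling-weight k zero r _ = trans (+-identityʳ _) (trans (sum-const r 1) (*-identityʳ r))
labelling-weight k@(suc k′) (suc m) r 1≤k = begin
  weight {suc m * 2 * suc k + r} (labelling k (suc m) ∘ toℕ) + suc m
    ≡⟨ cong (λ l → weight {l} (labelling k (suc m) ∘ toℕ) + suc m) reassoc ⟩
  weight {suc k + (suc k + l′)} (labelling k (suc m) ∘ toℕ) + suc m
    ≡⟨ cong (_+ suc m) (trans (sum-prepend (suc k) (suc k + l′) toℕ block₁ (prepend (suc k) block₂ (labelling k m)))
         (cong₂ _+_ block₁-sum (trans (sum-prepend (suc k) l′ toℕ block₂ (labelling k m)) (cong (_+ rest) block₂-sum)))) ⟩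
  suc k + (k + rest) + suc m
    ≡⟨ solve 3 (λ k w m → con 1 :+ k :+ (k :+ w) :+ (con 1 :+ m) := con 1 :+ k :+ (con 1 :+ k :+ (w :+ m))) refl k rest m ⟩
  suc k + (suc k + (rest + m))
    ≡⟨ cong (λ x → suc k + (suc k + x)) (labelling-weight k m r 1≤k) ⟩
  suc k + (suc k + l′)
    ≡⟨ reassoc ⟨
  suc m * 2 * suc k + r ∎
  where
  open ≡-Reasoning
  open +-*-Solver
  l′ = m * 2 * suc k + r
  rest = weight {l′} (labelling k m ∘ toℕ)
  reassoc : suc m * 2 * suc k + r ≡ suc k + (suc k + l′)
  reassoc = trans (+-assoc (suc k) _ r) (cong (suc k +_) (+-assoc (suc k) _ r))
  block₁-sum : ∑[ i < suc k ] toℕ (block₁ (toℕ i)) ≡ suc k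
  block₁-sum = cong (2 +_) (trans (sum-const k′ 1) (*-identityʳ k′))
  block₂-sum : ∑[ i < suc k ] toℕ (block₂ (toℕ i)) ≡ k
  block₂-sum = trans (sum-const k 1) (*-identityʳ k)

-- Upper bound: the labelling on the cycle

≢0F⇒≡1F⊎≡2F : ∀ {a : Fin 3} → a ≢ 0F → a ≡ 1F ⊎ a ≡ 2F
≢0F⇒≡1F⊎≡2F {0F} a≢0 = contradiction refl a≢0
≢0F⇒≡1F⊎≡2F {1F} _   = inj₁ refl
≢0F⇒≡1F⊎≡2F {2F} _   = inj₂ refl

module UpperBound {n k : ℕ} (m : ℕ) (2≤k : 2 ≤ k) (k<n : k < n) (fits : m * 2 * suc k ≤ n) where

  f : Fin n → Fin 3
  f = labelling k m ∘ toℕ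

  -- Zeros sit at multiples of k+1 below 2m(k+1) ≤ n, so they are more than k
  -- apart, also across the wrap-around.
  zeros-apart : ∀ u j → 1 ≤ j → j ≤ k → f u ≡ 0F → f (u ⊕ j) ≢ 0F
  zeros-apart u j 1≤j j≤k fu≡0 fv≡0
    with labelling-zero k m _ fu≡0 | labelling-zero k m _ fv≡0
       | ⊕-wrap u (≤-trans j≤k (<⇒≤ k<n))
  ... | q , q<2m , u≡ | q′ , _ , v≡ | inj₁ v≡u+j = <-irrefl refl (begin-strict
    q′ * suc k        ≡⟨ v≡ ⟨
    toℕ (u ⊕ j)       ≡⟨ v≡u+j ⟩
    toℕ u + j         ≡⟨ cong (_+ j) u≡ ⟩
    q * suc k + j     <⟨ +-monoʳ-< (q * suc k) (s≤s j≤k) ⟩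
    q * suc k + suc k ≡⟨ +-comm (q * suc k) (suc k) ⟩
    suc q * suc k     ≤⟨ *-monoˡ-≤ (suc k) (*-cancelʳ-< (suc k) q q′ (begin-strict
      q * suc k         ≡⟨ u≡ ⟨
      toℕ u             <⟨ m<m+n (toℕ u) 1≤j ⟩
      toℕ u + j         ≡⟨ v≡u+j ⟨
      toℕ (u ⊕ j)       ≡⟨ v≡ ⟩
      q′ * suc k        ∎)) ⟩
    q′ * suc k        ∎)
    where open ≤-Reasoning
  ... | q , q<2m , u≡ | q′ , _ , v≡ | inj₂ v+n≡u+j = <-irrefl refl (begin-strict
    n                 ≤⟨ m≤n+m n (toℕ (u ⊕ j)) ⟩
    toℕ (u ⊕ j) + n   ≡⟨ v+n≡u+j ⟩
    toℕ u + j         ≡⟨ cong (_+ j) u≡ ⟩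
    q * suc k + j     <⟨ +-monoʳ-< (q * suc k) (s≤s j≤k) ⟩
    q * suc k + suc k ≡⟨ +-comm (q * suc k) (suc k) ⟩
    suc q * suc k     ≤⟨ *-monoˡ-≤ (suc k) q<2m ⟩
    m * 2 * suc k     ≤⟨ fits ⟩
    n                 ∎)
    where open ≤-Reasoning

  isOITRDF : IsOITRDF (C n k) f
  isOITRDF = record { dominated = dominated ; independent = independent ; total = total }
    where
    1≤k : 1 ≤ k
    1≤k = <⇒≤ 2≤k

    dominated : ∀ v → f v ≡ 0F → ∃[ u ] (f u ≡ 2F × Adj (C n k) v u)
    dominated v fv≡0 with labelling-dominated k m (toℕ v) 1≤k fv≡0
    ... | w , lw≡2 , w< , near = u , fu≡2 , v≢u , adjacent near
      where
      w<n = <-≤-trans w< fits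
      u = fromℕ< w<n
      u≡w = toℕ-fromℕ< w<n
      fu≡2 : f u ≡ 2F
      fu≡2 = trans (cong (labelling k m) u≡w) lw≡2
      v≢u : v ≢ u
      v≢u v≡u with () ← trans (sym fv≡0) (trans (cong f v≡u) fu≡2)
      adjacent : w ≡ toℕ v + 1 ⊎ toℕ v ≡ w + k →
        ∃[ j ] (1 ≤ j × j ≤ k × (u ≡ v ⊕ j ⊎ v ≡ u ⊕ j))
      adjacent (inj₁ w≡v+1) = 1 , ≤-refl , 1≤k , inj₁ (toℕ≡+⇒≡⊕ v u 1 (trans u≡w w≡v+1))
      adjacent (inj₂ v≡w+k) = k , 1≤k , ≤-refl ,
        inj₂ (toℕ≡+⇒≡⊕ u v k (trans v≡w+k (cong (_+ k) (sym u≡w))))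

    independent : Independent (C n k) (V f 0F)
    independent u v fu≡0 fv≡0 (_ , j , 1≤j , j≤k , inj₁ refl) = zeros-apart u j 1≤j j≤k fu≡0 fv≡0
    independent u v fu≡0 fv≡0 (_ , j , 1≤j , j≤k , inj₂ refl) = zeros-apart v j 1≤j j≤k fv≡0 fu≡0

    -- Of the adjacent vertices v ⊕ 1 and v ⊕ 2 at most one is labelled 0.
    total : ∀ v → f v ≡ 1F ⊎ f v ≡ 2F → ∃[ u ] ((f u ≡ 1F ⊎ f u ≡ 2F) × Adj (C n k) v u)
    total v _ with f (v ⊕ 1) in f₁≡
    ... | 0F = v ⊕ 2 , ≢0F⇒≡1F⊎≡2F (zeros-apart (v ⊕ 1) 1 ≤-refl 1≤k f₁≡ ∘ trans (cong f (⊕-⊕ v 1 1)))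
             , adjacent-⊕ v k<n (s≤s z≤n) 2≤k
    ... | 1F = v ⊕ 1 , inj₁ f₁≡ , adjacent-⊕ v k<n ≤-refl 1≤k
    ... | 2F = v ⊕ 1 , inj₂ f₁≡ , adjacent-⊕ v k<n ≤-refl 1≤k

  weight-f : weight f ≡ n ∸ m
  weight-f = begin
    weight f          ≡⟨ m+n∸n≡m (weight f) m ⟨
    -- The number of trailing ones is taken to be `n ∸ m * 2 * suc k`, which makes the total length
    -- `n`.
    weight f + m ∸ m  ≡⟨ cong (_∸ m) (subst (λ l → weight {l} (labelling k m ∘ toℕ) + m ≡ l)
                           (m+[n∸m]≡n fits) (labelling-weight k m _ (<⇒≤ 2≤k))) ⟩
    n ∸ m             ∎
    where open ≡-Reasoning

theorem3p3 : ∀ (n k : ℕ) → 2 ≤ k → k ≤ n / 2 →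
    γoitR (C n k) ≔ (n ∸ (n / suc k) / 2)
theorem3p3 n k 2≤k k≤n/2 = record
  { attained = f , isOITRDF , weight-f
  ; minimal  = λ _ → LowerBound.n∸half≤weight k<n
  }
  where
  open ≤-Reasoning
  k<n : k < n
  -- Strictness comes from `k` being positive, while `k * 2` is at most `n`.
  k<n = begin-strict
    k         <⟨ m<m*n k 2 {{>-nonZero (<⇒≤ 2≤k)}} ≤-refl ⟩
    k * 2     ≤⟨ *-monoˡ-≤ 2 k≤n/2 ⟩
    n / 2 * 2 ≤⟨ m/n*n≤m n 2 ⟩
    n         ∎
  fits : n / suc k / 2 * 2 * suc k ≤ n
  fits = begin
    n / suc k / 2 * 2 * suc k ≤⟨ *-monoˡ-≤ (suc k) (m/n*n≤m (n / suc k) 2) ⟩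
    n / suc k * suc k         ≤⟨ m/n*n≤m n (suc k) ⟩
    n                         ∎
  open UpperBound (n / suc k / 2) 2≤k k<n fits
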